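{- Let $S$ be a commutative semiring. For each WAFA $\mathcal A$ over $S$ and an alphabet $\Sigma$ there exists an equivalent WAFA $\mathcal A'=(Q,\Sigma,\delta,P_0,\tau)$, $Q=\{q_1,\dots,q_n\}$, over $S$ and $\Sigma$ such that: (i) $\delta(q,a)$ is a finite sum of pairwise distinct monomials of the form $s\cdot q_1^{k_1}\cdots q_n^{k_n}$ for all $q\in Q$, $a\in\Sigma$; (ii) all monomials in $P_0$ and $\delta$ are proper; (iii) $P_0=q_1$; (iv) all monomials in $P_0$ and $\delta$ have coefficient $1$. The construction of $\mathcal A'$ is effective.
   Context: An alphabet is a finite non-empty set; $\Sigma^*$ is the set of finite words over $\Sigma$, $\varepsilon$ the empty word. A semiring $(S,+,\cdot,0,1)$ has $(S,+,0)$ a commutative monoid, $(S,\cdot,1)$ a monoid, $0$ absorbing, and both distributive laws; it is commutative if $\cdot$ is commutative. For $Q=\{q_1,\dots,q_n\}$, $S[Q]$ is the semiring of polynomials with coefficients in $S$ in commuting indeterminates $q_1,\dots,q_n$; $p\langle s_1,\dots,s_n\rangle$ denotes simultaneous substitution. A monomial is $s\cdot q_1^{k_1}\cdots q_n^{k_n}$ with coefficient $s\in S$ and $k_i\in\mathbb N$; its degree is $\sum_i k_i$; it is proper if its degree is non-zero. The zero polynomial is the empty sum of monomials. A weighted alternating finite automaton (WAFA) over $S$ and $\Sigma$ is $\mathcal A=(Q,\Sigma,\delta,P_0,\tau)$ with $Q=\{q_1,\dots,q_n\}$ a finite set of states, $\delta:Q\times\Sigma\to S[Q]$, $P_0\in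 S[Q]$, $\tau:Q\to S$. State behavior: $[\mathcal A]_q(\varepsilon)=\tau(q)$, $[\mathcal A]_q(av)=\delta(q,a)\langle[\mathcal A]_{q_1}(v),\dots,[\mathcal A]_{q_n}(v)\rangle$ for $a\in\Sigma$. Behavior: $[\![\mathcal A]\!](w)=P_0\langle[\mathcal A]_{q_1}(w),\dots,[\mathcal A]_{q_n}(w)\rangle$. Two WAFA are equivalent if they have the same behavior. "Monomials in $\delta$" means the monomials appearing in some $\delta(q,a)$. -}

module Defs where

open import Algebra.Bundles using (CommutativeSemiring)
open import Data.Fin.Base using (Fin)
open import Data.List.Base as List using (List; []; _∷_)
open import Data.List.Relation.Unary.All using (All)
open import Data.List.Relation.Unary.Unique.Propositional using (Unique)
open import Data.Nat.Base using (ℕ)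
open import Data.Product.Base using (_×_)
open import Data.Vec.Base as Vec using (Vec; _[_]≔_)
open import Level using (_⊔_)
open import Relation.Binary.PropositionalEquality using (_≢_)

module _ {c ℓ} (S : CommutativeSemiring c ℓ) where
  open CommutativeSemiring S
  open import Algebra.Definitions.RawSemiring rawSemiring using (_^_; product)

  -- s · q₁^k₁ ⋯ qₙ^kₙ, where Vec.lookup exponents i is the exponent of the
  -- i-th indeterminate.
  record Monomial (n : ℕ) : Set c where
    constructor _·q^_
    field
      coefficient : Carrier
      exponents   : Vec ℕ n

  open Monomial public

  degree : ∀ {n} → Monomial n → ℕ
  degree m = Vec.sum (exponents m)

  Proper : ∀ {n} → Monomial n → Set
  Proper m = degree m ≢ 0

  HasCoefficient1 : ∀ {n} → Monomial n → Set ℓ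
  HasCoefficient1 m = coefficient m ≈ 1#

  -- An element of S[q₁,…,qₙ] is presented as a finite formal sum of monomials;
  -- [] is the zero polynomial.  Every polynomial has such a presentation, in
  -- general many: the same exponents may occur several times, and zero
  -- coefficients are allowed, as S need not have decidable equality.  The
  -- monomials in a polynomial are the summands of its presentation.
  Polynomial : ℕ → Set c
  Polynomial n = List (Monomial n)

  -- Monomials are distinguished by their exponents alone, so s·q and t·q in one
  -- sum are excluded even when s and t differ.  For sums whose coefficients are
  -- all 1 this is the same as being distinct as pairs (coefficient, exponents).
  PairwiseDistinct : ∀ {n} → Polynomial n → Set
  PairwiseDistinct p = Unique (List.map exponents p)

  indeterminate : ∀ {n} → Fin n → Polynomial n
  indeterminate {n} i = (1# ·q^ (Vec.replicate n 0 [ i ]≔ 1)) ∷ []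

  infix 9 _⟨_⟩ₘ _⟨_⟩

  _⟨_⟩ₘ : ∀ {n} → Monomial n → (Fin n → Carrier) → Carrier
  m ⟨ s ⟩ₘ = coefficient m * product (λ i → s i ^ Vec.lookup (exponents m) i)

  _⟨_⟩ : ∀ {n} → Polynomial n → (Fin n → Carrier) → Carrier
  p ⟨ s ⟩ = List.foldr _+_ 0# (List.map (_⟨ s ⟩ₘ) p)

  -- The states q₁,…,qₙ are the elements of Fin n.
  record WAFA {a} (Symbol : Set a) (n : ℕ) : Set (a ⊔ c) where
    field
      δ  : Fin n → Symbol → Polynomial n
      P₀ : Polynomial n
      τ  : Fin n → Carrier

  module _ {a} {Symbol : Set a} where

    stateBehavior : ∀ {n} → WAFA Symbol n → List Symbol → Fin n → Carrier
    stateBehavior A []      q = WAFA.τ A q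
    stateBehavior A (x ∷ v) q = WAFA.δ A q x ⟨ stateBehavior A v ⟩

    behavior : ∀ {n} → WAFA Symbol n → List Symbol → Carrier
    behavior A w = WAFA.P₀ A ⟨ stateBehavior A w ⟩

    Equivalent : ∀ {m n} → WAFA Symbol m → WAFA Symbol n → Set (a ⊔ ℓ)
    Equivalent A B = ∀ w → behavior A w ≈ behavior B w

    AllMonomials : ∀ {n p} → (Monomial n → Set p) → WAFA Symbol n → Set (a ⊔ c ⊔ p)
    AllMonomials P A = All P (WAFA.P₀ A) × (∀ q x → All P (WAFA.δ A q x))

{-# OPTIONS --safe #-}

-- A fresh initial state q₁ gets τ(q₁) = P₀⟨τ⟩, and δ(q₁, a) is P₀ with δ(q, a)
-- substituted for every q, so its state behavior is the behavior of the original
-- automaton.  The coefficients are then moved into states: every occurrence of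
-- a monomial in δ gets its own state, which keeps the coefficient of that
-- monomial as its value on all words, and the coefficient is replaced by that
-- state.  All monomials become proper and, since no two occurrences share a
-- state, pairwise distinct, without ever comparing elements of S.
module Submission where

open import Defs
open import Algebra.Bundles using (CommutativeSemiring)
import Algebra.Definitions.RawSemiring as RawSemiringDefinitions
import Algebra.Properties.CommutativeMonoid.Sum as Sum
import Algebra.Properties.CommutativeSemigroup as CommutativeSemigroupProperties
import Algebra.Properties.Semiring.Exp as Exp
open import Data.Fin.Base using (Fin; zero; suc; _↑ˡ_; _↑ʳ_; splitAt; combine; remQuot)
open import Data.Fin.Properties using (_≟_; splitAt-↑ˡ; splitAt-↑ʳ; ↑ˡ-injective; ↑ʳ-injective; remQuot-combine)
open import Data.List.Base as List using (List; []; _∷_; _++_; length)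
open import Data.List.Properties using (tabulate-lookup; map-tabulate)
open import Data.List.Relation.Unary.All using (All; []; _∷_)
import Data.List.Relation.Unary.All.Properties as All
open import Data.List.Relation.Unary.AllPairs using ([]; _∷_)
open import Data.List.Relation.Unary.Unique.Propositional using (Unique)
open import Data.List.Relation.Unary.Unique.Propositional.Properties using (tabulate⁺)
open import Data.Nat.Base as ℕ using (ℕ; zero; suc)
open import Data.Nat.Properties using (m+n≡0⇒n≡0)
open import Data.Product.Base using (Σ-syntax; ∃-syntax; _×_; _,_; proj₁; proj₂)
open import Data.Sum.Base using (inj₁; inj₂; [_,_]′)
open import Data.Vec.Base as Vec using (Vec; []; _∷_; _[_]≔_)
open import Data.Vec.Functional as Vector using (Vector)
import Data.Vec.Functional.Properties as Vector
open import Data.Vec.Properties using (lookup∘update; lookup∘update′; lookup-replicate; lookup-zipWith; sum-++; ++-injectiveʳ)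
open import Function.Base using (_∘_)
open import Function.Bundles using (_↔_; Inverse)
open import Function.Definitions using (Injective)
open import Level using (_⊔_)
open import Relation.Binary.PropositionalEquality as ≡ using (_≡_; _≢_; cong; subst)
import Relation.Binary.Reasoning.Setoid as SetoidReasoning
open import Relation.Nullary using (yes; no; contradiction)

-- Exponent vectors of single indeterminates.

unit : ∀ {n} → Fin n → Vec ℕ n
unit {n} i = Vec.replicate n 0 [ i ]≔ 1

sum-unit : ∀ {n} (i : Fin n) → Vec.sum (unit i) ≢ 0
sum-unit zero    ()
sum-unit (suc i) = sum-unit i

unit-injective : ∀ {n} → Injective _≡_ _≡_ (unit {n})
unit-injective {n} {i} {j} eq with i ≟ j
... | yes i≡j = i≡j
... | no  i≢j = contradiction 1≡0 λ ()
  where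
  open ≡.≡-Reasoning
  1≡0 : 1 ≡ 0
  1≡0 = begin
    1                                 ≡⟨ lookup∘update i (Vec.replicate n 0) 1 ⟨
    Vec.lookup (unit i) i             ≡⟨ cong (λ v → Vec.lookup v i) eq ⟩
    Vec.lookup (unit j) i             ≡⟨ lookup∘update′ i≢j (Vec.replicate n 0) 1 ⟩
    Vec.lookup (Vec.replicate n 0) i  ≡⟨ lookup-replicate i 0 ⟩
    0                                 ∎

-- Numbering the occurrences in a finite family of lists.

-- Positions are numbered, not values, so equal entries at different positions of a list get
-- different numbers and `B` needs no equality test. Injectivity is recorded within each list only,
-- since monomials have to be distinct only within a single transition.
record Pool {b} {B : Set b} {k} (xss : Fin k → List B) : Set b where
  field
    size            : ℕ
    content         : Vector B size
    index           : ∀ i → Fin (length (xss i)) → Fin size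
    index-injective : ∀ i → Injective _≡_ _≡_ (index i)
    content-index   : ∀ i j → content (index i j) ≡ List.lookup (xss i) j

-- The lists are laid end to end: the first takes the initial block of numbers, and the numbers of
-- the remaining ones are shifted past it.
pool : ∀ {b} {B : Set b} {k} (xss : Fin k → List B) → Pool xss
pool {k = zero} xss = record
  { size = 0 ; content = λ () ; index = λ () ; index-injective = λ () ; content-index = λ () }
pool {k = suc k} xss = record
  { size            = length (xss zero) ℕ.+ size
  ; content         = List.lookup (xss zero) Vector.++ content
  ; index           = λ { zero → _↑ˡ size ; (suc i) → (length (xss zero) ↑ʳ_) ∘ index i }
  ; index-injective = λ { zero → ↑ˡ-injective size _ _
                        ; (suc i) → index-injective i ∘ ↑ʳ-injective (length (xss zero)) _ _ }
  ; content-index   = λ { zero j → Vector.lookup-++ˡ (List.lookup (xss zero)) content j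
                        ; (suc i) j → ≡.trans
                            (Vector.lookup-++ʳ (List.lookup (xss zero)) content (index i j))
                            (content-index i j) }
  }
  where open Pool (pool (xss ∘ suc))

module _ {c ℓ} (S : CommutativeSemiring c ℓ) where
  open CommutativeSemiring S hiding (zero)
  open RawSemiringDefinitions rawSemiring using (_^_; product)
  open CommutativeSemigroupProperties *-commutativeSemigroup using (interchange)
  open Exp semiring using (^-congˡ; ^-homo-*)
  open Sum *-commutativeMonoid using () renaming
    (sum-cong-≋ to product-cong; ∑-distrib-+ to product-distrib-*)
  open SetoidReasoning setoid

  -- Evaluation of monomials and polynomials.

  infix 9 _⟦_⟧

  _⟦_⟧ : ∀ {n} → Polynomial S n → Vector Carrier n → Carrier
  p ⟦ s ⟧ = _⟨_⟩ S p s

  infix 9 _^^_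

  _^^_ : ∀ {n} → Vector Carrier n → Vec ℕ n → Carrier
  s ^^ ks = product (λ i → s i ^ Vec.lookup ks i)

  ^^-replicate-0 : ∀ {n} (s : Vector Carrier n) → s ^^ Vec.replicate n 0 ≈ 1#
  ^^-replicate-0 {zero}  s = refl
  ^^-replicate-0 {suc n} s = trans (*-identityˡ _) (^^-replicate-0 (s ∘ suc))

  ^^-unit : ∀ {n} (s : Vector Carrier n) i → s ^^ unit i ≈ s i
  ^^-unit s zero    = trans (*-congˡ (^^-replicate-0 (s ∘ suc)))
                            (trans (*-identityʳ _) (*-identityʳ _))
  ^^-unit s (suc i) = trans (*-identityˡ _) (^^-unit (s ∘ suc) i)

  ^^-++ : ∀ {m n} (s : Vector Carrier (m ℕ.+ n)) (js : Vec ℕ m) (ks : Vec ℕ n) →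
          s ^^ (js Vec.++ ks) ≈ ((s ∘ (_↑ˡ n)) ^^ js) * ((s ∘ (m ↑ʳ_)) ^^ ks)
  ^^-++ s []       ks = sym (*-identityˡ _)
  ^^-++ s (j ∷ js) ks = trans (*-congˡ (^^-++ (s ∘ suc) js ks)) (sym (*-assoc _ _ _))

  ^^-+ : ∀ {n} (s : Vector Carrier n) (js ks : Vec ℕ n) →
         s ^^ Vec.zipWith ℕ._+_ js ks ≈ (s ^^ js) * (s ^^ ks)
  ^^-+ s js ks = begin
    s ^^ Vec.zipWith ℕ._+_ js ks
      ≈⟨ product-cong (λ i → trans (reflexive (cong (s i ^_) (lookup-zipWith ℕ._+_ i js ks)))
                                   (^-homo-* (s i) (Vec.lookup js i) (Vec.lookup ks i))) ⟩
    product (λ i → (s i ^ Vec.lookup js i) * (s i ^ Vec.lookup ks i))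
      ≈⟨ product-distrib-* (λ i → s i ^ Vec.lookup js i) (λ i → s i ^ Vec.lookup ks i) ⟩
    (s ^^ js) * (s ^^ ks) ∎

  ^^-congˡ : ∀ {n} {s t : Vector Carrier n} (ks : Vec ℕ n) → (∀ i → s i ≈ t i) → s ^^ ks ≈ t ^^ ks
  ^^-congˡ ks s≈t = product-cong (λ i → ^-congˡ (Vec.lookup ks i) (s≈t i))

  ⟦⟧-cong : ∀ {n} {s t : Vector Carrier n} (p : Polynomial S n) →
            (∀ i → s i ≈ t i) → p ⟦ s ⟧ ≈ p ⟦ t ⟧
  ⟦⟧-cong []              s≈t = refl
  ⟦⟧-cong ((a ·q^ ks) ∷ p) s≈t = +-cong (*-congˡ (^^-congˡ ks s≈t)) (⟦⟧-cong p s≈t)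

  ⟦⟧-indeterminate : ∀ {n} (i : Fin n) s → indeterminate S i ⟦ s ⟧ ≈ s i
  ⟦⟧-indeterminate i s = trans (+-identityʳ _) (trans (*-identityˡ _) (^^-unit s i))

  ⟦⟧-++ : ∀ {n} (p q : Polynomial S n) s → (p ++ q) ⟦ s ⟧ ≈ p ⟦ s ⟧ + q ⟦ s ⟧
  ⟦⟧-++ []      q s = sym (+-identityˡ _)
  ⟦⟧-++ (m ∷ p) q s = trans (+-congˡ (⟦⟧-++ p q s)) (sym (+-assoc _ _ _))

  -- The two sides may have different numbers of indeterminates, because moving coefficients into
  -- states enlarges the state set.
  ⟦⟧-tabulate-cong : ∀ {k m n} (f : Fin k → Monomial S m) (g : Fin k → Monomial S n) {s t} →
                     (∀ i → _⟨_⟩ₘ S (f i) s ≈ _⟨_⟩ₘ S (g i) t) →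
                     List.tabulate f ⟦ s ⟧ ≈ List.tabulate g ⟦ t ⟧
  ⟦⟧-tabulate-cong {zero}  f g f≈g = refl
  ⟦⟧-tabulate-cong {suc k} f g f≈g = +-cong (f≈g zero) (⟦⟧-tabulate-cong (f ∘ suc) (g ∘ suc) (f≈g ∘ suc))

  -- Functions induced by polynomials.

  -- Behaviors see a polynomial only through its values, so closure properties of functions can
  -- replace identities between formal sums. The pair carries an explicit polynomial, which keeps
  -- the construction effective.
  IsPolynomial : ∀ {n} → (Vector Carrier n → Carrier) → Set (c ⊔ ℓ)
  IsPolynomial f = ∃[ p ] ∀ s → p ⟦ s ⟧ ≈ f s

  module _ {n : ℕ} where

    const-isPolynomial : (a : Carrier) → IsPolynomial {n} (λ _ → a)
    const-isPolynomial a = (a ·q^ Vec.replicate n 0) ∷ [] , λ s →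
      trans (+-identityʳ _) (trans (*-congˡ (^^-replicate-0 s)) (*-identityʳ a))

    indeterminate-isPolynomial : (i : Fin n) → IsPolynomial (λ s → s i)
    indeterminate-isPolynomial i = indeterminate S i , ⟦⟧-indeterminate i

    +-isPolynomial : ∀ {f g} → IsPolynomial {n} f → IsPolynomial g → IsPolynomial (λ s → f s + g s)
    +-isPolynomial (p , p≈f) (q , q≈g) =
      p ++ q , λ s → trans (⟦⟧-++ p q s) (+-cong (p≈f s) (q≈g s))

    monomial-*-isPolynomial : (m : Monomial S n) (q : Polynomial S n) →
                              IsPolynomial (λ s → _⟨_⟩ₘ S m s * q ⟦ s ⟧)
    monomial-*-isPolynomial m [] = [] , λ s → sym (zeroʳ _)
    monomial-*-isPolynomial m@(a ·q^ js) ((b ·q^ ks) ∷ q) with monomial-*-isPolynomial m q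
    ... | r , r≈mq = ((a * b) ·q^ Vec.zipWith ℕ._+_ js ks) ∷ r , λ s → begin
      (a * b) * (s ^^ Vec.zipWith ℕ._+_ js ks) + r ⟦ s ⟧
        ≈⟨ +-cong (*-congˡ (^^-+ s js ks)) (r≈mq s) ⟩
      (a * b) * ((s ^^ js) * (s ^^ ks)) + (a * (s ^^ js)) * q ⟦ s ⟧
        -- Commutativity lets `b` pass the power product of the first monomial.
        ≈⟨ +-congʳ (interchange a b (s ^^ js) (s ^^ ks)) ⟩
      (a * (s ^^ js)) * (b * (s ^^ ks)) + (a * (s ^^ js)) * q ⟦ s ⟧
        ≈⟨ distribˡ _ _ _ ⟨
      (a * (s ^^ js)) * (b * (s ^^ ks) + q ⟦ s ⟧) ∎

    *-isPolynomial : ∀ {f g} → IsPolynomial {n} f → IsPolynomial g → IsPolynomial (λ s → f s * g s)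
    *-isPolynomial (p , p≈f) (q , q≈g) with go p
      -- Multiplication is first done on the presentations, by induction on `p` with distributivity,
      -- and then carried over to `f` and `g`.
      where
      go : (p : Polynomial S n) → IsPolynomial (λ s → p ⟦ s ⟧ * q ⟦ s ⟧)
      go []      = [] , λ s → sym (zeroˡ _)
      go (m ∷ p) with +-isPolynomial (monomial-*-isPolynomial m q) (go p)
      ... | r , r≈ = r , λ s → trans (r≈ s) (sym (distribʳ _ _ _))
    ... | r , r≈ = r , λ s → trans (r≈ s) (*-cong (p≈f s) (q≈g s))

    ^-isPolynomial : ∀ {f} → IsPolynomial {n} f → ∀ k → IsPolynomial (λ s → f s ^ k)
    ^-isPolynomial F zero    = const-isPolynomial 1#
    ^-isPolynomial F (suc k) = *-isPolynomial F (^-isPolynomial F k)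

    product-isPolynomial : ∀ {k} {f : Fin k → Vector Carrier n → Carrier} →
                           (∀ i → IsPolynomial (f i)) → IsPolynomial (λ s → product (λ i → f i s))
    product-isPolynomial {zero}  F = const-isPolynomial 1#
    product-isPolynomial {suc k} F = *-isPolynomial (F zero) (product-isPolynomial (F ∘ suc))

    -- Follows the syntax of `p`: the substituted value is built from constants and the `f i` by
    -- powers, products and sums. This yields composite transitions, and also renaming of
    -- indeterminates.
    substitution-isPolynomial : ∀ {k} (p : Polynomial S k) {f : Fin k → Vector Carrier n → Carrier} →
                                (∀ i → IsPolynomial (f i)) → IsPolynomial (λ s → p ⟦ (λ i → f i s) ⟧)
    substitution-isPolynomial []               F = [] , λ s → refl
    substitution-isPolynomial ((a ·q^ ks) ∷ p) F = +-isPolynomial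
      (*-isPolynomial (const-isPolynomial a)
                      (product-isPolynomial (λ i → ^-isPolynomial (F i) (Vec.lookup ks i))))
      (substitution-isPolynomial p F)

  -- Normalized polynomials.

  -- Bundles conditions (i), (ii) and (iv) for a single polynomial.
  Normal : ∀ {n} → Polynomial S n → Set (c ⊔ ℓ)
  Normal p = PairwiseDistinct S p × All (Proper S) p × All (HasCoefficient1 S) p

  indeterminate-normal : ∀ {n} (i : Fin n) → Normal (indeterminate S i)
  indeterminate-normal i = [] ∷ [] , sum-unit i ∷ [] , refl ∷ []

  module _ {a} {Symbol : Set a} where

    -- The fresh initial state.

    withInitialState : ∀ {n} (A : WAFA S Symbol n) →
      Σ[ B ∈ WAFA S Symbol (suc n) ] ∀ w → behavior S A w ≈ stateBehavior S B w zero
    withInitialState {n} A = B , λ w → sym (B-zero w)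
      where
      open WAFA A

      -- Old states are shifted by `suc` to free index `zero`; the renaming is a substitution of
      -- indeterminates.
      old : ∀ q x → IsPolynomial {suc n} (λ s → δ q x ⟦ s ∘ suc ⟧)
      old q x = substitution-isPolynomial (δ q x) (indeterminate-isPolynomial ∘ suc)

      new : ∀ x → IsPolynomial {suc n} (λ s → P₀ ⟦ (λ q → δ q x ⟦ s ∘ suc ⟧) ⟧)
      new x = substitution-isPolynomial P₀ (λ q → old q x)

      B : WAFA S Symbol (suc n)
      B = record
        { δ  = λ { zero x → proj₁ (new x) ; (suc q) x → proj₁ (old q x) }
        ; P₀ = indeterminate S zero
        ; τ  = λ { zero → P₀ ⟦ τ ⟧ ; (suc q) → τ q }
        }

      B-suc : ∀ w q → stateBehavior S B w (suc q) ≈ stateBehavior S A w q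
      B-suc []      q = refl
      B-suc (x ∷ w) q = trans (proj₂ (old q x) (stateBehavior S B w)) (⟦⟧-cong (δ q x) (B-suc w))

      B-zero : ∀ w → stateBehavior S B w zero ≈ behavior S A w
      B-zero []      = refl
      -- No induction hypothesis for `zero` is called for: after one letter only the values at the
      -- old states matter.
      B-zero (x ∷ w) = trans (proj₂ (new x) (stateBehavior S B w)) (⟦⟧-cong P₀ (λ q → ⟦⟧-cong (δ q x) (B-suc w)))

    -- Moving the coefficients into states.

    module _ {k n} (Symbol↔Fin : Symbol ↔ Fin k) (A : WAFA S Symbol n) where
      open WAFA A
      open Inverse Symbol↔Fin using (to; from; strictlyInverseʳ)

      -- Lists all pairs of a state and a letter as one finite family. Finiteness of the alphabet
      -- enters here: it makes the pool of coefficient states finite.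
      transition : Fin (n ℕ.* k) → Polynomial S n
      transition i = let (q , j) = remQuot k i in δ q (from j)

      transition-combine : ∀ q x → transition (combine q (to x)) ≡ δ q x
      transition-combine q x = ≡.trans
        (cong (λ (q , j) → δ q (from j)) (remQuot-combine q (to x)))
        (cong (δ q) (strictlyInverseʳ x))

      open Pool (pool transition)

      -- The first `n` indeterminates are the old states and the last `size` are the coefficient
      -- states; the latter block contributes exactly one factor, belonging to this occurrence.
      normalMonomial : ∀ i → Fin (length (transition i)) → Monomial S (n ℕ.+ size)
      normalMonomial i j =
        1# ·q^ (exponents (List.lookup (transition i) j) Vec.++ unit (index i j))

      normalTransition : Fin (n ℕ.* k) → Polynomial S (n ℕ.+ size)
      normalTransition i = List.tabulate (normalMonomial i)

      -- The appended unit vector does all the work: it differs from one occurrence to another, and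
      -- it makes the degree non-zero even for a monomial that was constant.
      normalTransition-normal : ∀ i → Normal (normalTransition i)
      normalTransition-normal i =
          subst Unique (≡.sym (map-tabulate (normalMonomial i) (exponents)))
            (tabulate⁺ (λ {j} {j′} eq → index-injective i (unit-injective (++-injectiveʳ _ _ eq))))
        , All.tabulate⁺ (λ j eq → sum-unit (index i j) (m+n≡0⇒n≡0 _
            (≡.trans (≡.sym (sum-++ (exponents (List.lookup (transition i) j)))) eq)))
        , All.tabulate⁺ (λ _ → refl)

      -- One letter of the simulation: if every coefficient state holds its coefficient, the extra
      -- factor restores the coefficient that was replaced by `1#`.
      normalTransition-⟦⟧ : ∀ i {s : Vector Carrier (n ℕ.+ size)} {t : Vector Carrier n} →
        (∀ q → s (q ↑ˡ size) ≈ t q) → (∀ j → s (n ↑ʳ j) ≈ coefficient (content j)) →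
        normalTransition i ⟦ s ⟧ ≈ transition i ⟦ t ⟧
      normalTransition-⟦⟧ i {s} {t} s≈t s≈c = begin
        normalTransition i ⟦ s ⟧
          ≈⟨ ⟦⟧-tabulate-cong (normalMonomial i) (List.lookup (transition i)) monomial≈ ⟩
        List.tabulate (List.lookup (transition i)) ⟦ t ⟧
          ≡⟨ cong (_⟦ t ⟧) (tabulate-lookup (transition i)) ⟩
        transition i ⟦ t ⟧ ∎
        where
        monomial≈ : ∀ j → _⟨_⟩ₘ S (normalMonomial i j) s ≈ _⟨_⟩ₘ S (List.lookup (transition i) j) t
        monomial≈ j = begin
          1# * (s ^^ (ks Vec.++ unit (index i j)))
            ≈⟨ *-identityˡ _ ⟩
          s ^^ (ks Vec.++ unit (index i j))
            ≈⟨ ^^-++ s ks (unit (index i j)) ⟩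
          ((s ∘ (_↑ˡ size)) ^^ ks) * ((s ∘ (n ↑ʳ_)) ^^ unit (index i j))
            ≈⟨ *-cong (^^-congˡ ks s≈t) (^^-unit (s ∘ (n ↑ʳ_)) (index i j)) ⟩
          (t ^^ ks) * s (n ↑ʳ index i j)
            ≈⟨ *-comm _ _ ⟩
          s (n ↑ʳ index i j) * (t ^^ ks)
            ≈⟨ *-congʳ (s≈c (index i j)) ⟩
          coefficient (content (index i j)) * (t ^^ ks)
            ≡⟨ cong (λ m → coefficient m * (t ^^ ks)) (content-index i j) ⟩
          coefficient (List.lookup (transition i) j) * (t ^^ ks) ∎
          where ks = exponents (List.lookup (transition i) j)

      normalization : Fin n → WAFA S Symbol (n ℕ.+ size)
      normalization q₀ = record
        { δ  = λ i x → [ (λ q → normalTransition (combine q (to x)))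
                       -- A coefficient state moves to itself on every letter, so it keeps its
                       -- terminal value.
                       , (λ j → indeterminate S (n ↑ʳ j)) ]′ (splitAt n i)
        ; P₀ = indeterminate S (q₀ ↑ˡ size)
        ; τ  = [ τ , coefficient ∘ content ]′ ∘ splitAt n
        }

      normalization-δ-normal : ∀ q₀ i x → Normal (WAFA.δ (normalization q₀) i x)
      normalization-δ-normal q₀ i x with splitAt n i
      ... | inj₁ q = normalTransition-normal (combine q (to x))
      ... | inj₂ j = indeterminate-normal (n ↑ʳ j)

      normalization-constant : ∀ q₀ w j →
        stateBehavior S (normalization q₀) w (n ↑ʳ j) ≈ coefficient (content j)
      normalization-constant q₀ []      j rewrite splitAt-↑ʳ n size j = refl
      normalization-constant q₀ (x ∷ w) j rewrite splitAt-↑ʳ n size j =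
        trans (⟦⟧-indeterminate (n ↑ʳ j) _) (normalization-constant q₀ w j)

      -- Induction on the word; the constancy of the coefficient states supplies the second
      -- hypothesis of `normalTransition-⟦⟧`.
      normalization-stateBehavior : ∀ q₀ w q →
        stateBehavior S (normalization q₀) w (q ↑ˡ size) ≈ stateBehavior S A w q
      normalization-stateBehavior q₀ []      q rewrite splitAt-↑ˡ n q size = refl
      normalization-stateBehavior q₀ (x ∷ w) q rewrite splitAt-↑ˡ n q size = trans
        (normalTransition-⟦⟧ (combine q (to x))
          (normalization-stateBehavior q₀ w) (normalization-constant q₀ w))
        (reflexive (cong (_⟦ stateBehavior S A w ⟧) (transition-combine q x)))

      normalization-behavior : ∀ q₀ w → behavior S (normalization q₀) w ≈ stateBehavior S A w q₀
      normalization-behavior q₀ w =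
        trans (⟦⟧-indeterminate (q₀ ↑ˡ size) _) (normalization-stateBehavior q₀ w q₀)

lemma3p1 : ∀ {c ℓ a} (S : CommutativeSemiring c ℓ)
    (Symbol : Set a) (k : ℕ) → Symbol ↔ Fin (suc k) →
    (n : ℕ) (A : WAFA S Symbol n) →
    ∃[ m ] Σ[ A′ ∈ WAFA S Symbol (suc m) ]
    ( Equivalent S A A′
    × (∀ q x → PairwiseDistinct S (WAFA.δ A′ q x))
    × AllMonomials S (Proper S) A′
    × WAFA.P₀ A′ ≡ indeterminate S zero
    × AllMonomials S (HasCoefficient1 S) A′ )
lemma3p1 S Symbol k Symbol↔Fin n A with withInitialState S A
... | B , A≈B =
    -- `B` has `suc n` states, so the total, `suc n` plus the size of the pool, computes to a
    -- successor and determines the witness.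
    _ , normalization S Symbol↔Fin B zero
  , (λ w → trans (A≈B w) (sym (normalization-behavior S Symbol↔Fin B zero w)))
  , (λ q x → proj₁ (δ-normal q x))
  , (proj₁ (proj₂ P₀-normal) , λ q x → proj₁ (proj₂ (δ-normal q x)))
  -- `zero ↑ˡ size` computes to `zero`, so the chosen state is still the first one.
  , ≡.refl
  , (proj₂ (proj₂ P₀-normal) , λ q x → proj₂ (proj₂ (δ-normal q x)))
  where
  open CommutativeSemiring S using (trans; sym)
  P₀-normal = indeterminate-normal S zero
  δ-normal  = normalization-δ-normal S Symbol↔Fin B zero
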